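{- Assume the $abc$-conjecture. Then \[ \frac{1}{2} \le \theta_4 \le \frac{4}{5}, \qquad \frac{1}{2} \le \theta_5 \le \frac{9}{10}, \qquad \text{and} \qquad \frac{1}{2} \le \theta_k \le 1 - \frac{1}{10 \cdot 3^{k-5}} \ \text{ for all integers } k \ge 5. \]
   Context: A positive integer $n$ is powerful if $p^2 \mid n$ for every prime $p \mid n$. For an integer $k \ge 3$, a $k$-term arithmetic progression of powerful numbers is a sequence $N, N+d, \dots, N+(k-1)d$ with positive integers $N$ and $d$ (so $d>0$) all of whose terms are powerful. A real number $0<\theta<1$ is called an admissible exponent (for $k$) if there exists a constant $C_\theta>0$ such that there are infinitely many $k$-term arithmetic progressions of powerful numbers $N, N+d, \dots, N+(k-1)d$ with $d \le C_\theta N^\theta$; $\theta_k$ denotes the infimum of all admissible exponents for $k$. The $abc$-conjecture states: for every $\epsilon>0$ there is a constant $C_\epsilon>0$ such that for all integers $a,b,c$ with $a+b=c$ and $\gcd(a,b)=1$, one has $\max\{|a|,|b|,|c|\} \le C_\epsilon\, \kappa(abc)^{1+\epsilon}$, where $\kappa(m)=\prod_{p\mid m} p$ is the product of the distinct primes dividing $m$. -}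

module Defs where

open import Data.Nat using (ℕ; zero; suc; _+_; _*_; _∸_; _^_; _≤_; _<_)
open import Data.Nat.Divisibility using (_∣_; _∣?_)
open import Data.Nat.Primality using (Prime; prime?)
open import Data.Nat.Coprimality using (Coprime)
open import Data.List using (List; filter; upTo)
open import Data.Nat.ListAction using (product)
open import Data.List.Membership.Propositional using (_∉_)
open import Data.Product using (_×_; _,_; Σ; ∃-syntax)
open import Relation.Nullary.Decidable using (_×-dec_)

rad : ℕ → ℕ
rad m = product (filter (λ p → prime? p ×-dec (p ∣? m)) (upTo (suc m)))

Powerful : ℕ → Set
Powerful n = (0 < n) × (∀ p → Prime p → p ∣ n → p ^ 2 ∣ n)

PowerfulAP : ℕ → ℕ → ℕ → Set
PowerfulAP k N d = ∀ i → i < k → Powerful (N + i * d)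

-- abc-conjecture, for ε = r/s (rational ε > 0 suffices by monotonicity in ε,
-- since κ ≥ 1), and a real constant C_ε replaced by a natural constant C
-- standing for ⌈C_ε⌉^s:  c^s ≤ C · κ(abc)^(s+r)  ⇔  c ≤ C^(1/s) κ^(1+r/s).
-- Stated for positive coprime a, b with c = a + b (the general integer
-- version with nonzero a,b,c reduces to this by moving signs).
ABC : Set
ABC = ∀ r s → 0 < r → 0 < s →
      Σ ℕ λ C → ∀ a b → 0 < a → 0 < b → Coprime a b →
        (a + b) ^ s ≤ C * rad (a * b * (a + b)) ^ (s + r)

-- θ = p/q (0 < θ < 1) is an admissible exponent for k:
-- ∃ C such that infinitely many k-term APs of powerful numbers (N, d),
-- N > 0, d > 0, satisfy d ≤ C_θ N^θ, i.e. d^q ≤ C · N^p with C = ⌈C_θ⌉^q.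
-- "Infinitely many" = not contained in any finite list of pairs (N , d).
Admissible : ℕ → ℕ → ℕ → Set
Admissible k p q =
  (0 < p) × (p < q) ×
  (Σ ℕ λ C → (L : List (ℕ × ℕ)) →
     ∃[ N ] ∃[ d ] ((0 < N) × (0 < d) × ((N , d) ∉ L) ×
                    PowerfulAP k N d × (d ^ q ≤ C * N ^ p)))

HalfLeTheta : ℕ → Set
HalfLeTheta k = ∀ p q → Admissible k p q → q ≤ 2 * p

-- θ_k ≤ a/b : for every ε = r/s > 0 there is an admissible p/q < a/b + r/s.
ThetaLe : ℕ → ℕ → ℕ → Set
ThetaLe k a b = ∀ r s → 0 < r → 0 < s →
  ∃[ p ] ∃[ q ] (Admissible k p q × (p * b * s < q * (a * s + r * b)))

D : ℕ → ℕ
D k = 10 * 3 ^ (k ∸ 5)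

{-# OPTIONS --safe #-}

-- Lower bound.  Let g be the gcd of N and d, and write N = ng, d = δg.  Apply abc to
-- n (n + 2δ) + δ² = (n + δ)².  A prime p dividing one of the three terms n, n + δ, n + 2δ
-- divides the corresponding powerful number of the progression, so p² divides
-- H = g · n · (n + δ) · (n + 2δ) · δ², and therefore the square of the radical is at most H.
-- This gives N ≪ d^(2+ε).
--
-- Upper bound.  Take n = 8w² and n + 1 = y² from Pell's equation, put
-- G = (n+2)(n+3)⋯(n+k-1), and multiply n, n + 1, …, n + k - 1 by G².  All terms become
-- powerful, with d = G² ≪ n^(2k-4) and N = nG², so 1 - 1/(2k-3) is admissible; this is 4/5
-- for k = 4 and is better than the required bound for k ≥ 5.
module Submission where

open import Defs
open import Data.Nat using (ℕ; zero; suc; _+_; _*_; _∸_; _^_; _≤_; _<_)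
open import Data.Nat using (z≤n; s≤s; s≤s⁻¹; z<s; NonZero; >-nonZero; >-nonZero⁻¹; ≢-nonZero)
open import Data.Nat.Properties
open import Data.Nat.Divisibility
open import Data.Nat.DivMod using (_/_; m/n*n≡m)
open import Data.Nat.GCD using (gcd; gcd[m,n]∣m; gcd[m,n]∣n; gcd[m,n]≢0)
open import Data.Nat.Coprimality using (Coprime; coprime-/gcd; coprime-divisor)
import Data.Nat.Coprimality as Coprimality
open import Data.Nat.ListAction using (product)
open import Data.Nat.Primality using (Prime; prime?; euclidsLemma; prime⇒irreducible)
open import Data.Nat.Primality using (prime⇒nonZero; ¬prime[1])
open import Data.Nat.Tactic.RingSolver using (solve-∀)
open import Data.List using (List; []; _∷_; filter; upTo; map; cartesianProduct)
open import Data.List.Extrema.Nat using (max; xs≤max)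
open import Data.List.Membership.Propositional using (_∉_)
open import Data.List.Membership.Propositional.Properties using (∈-cartesianProduct⁺; ∈-upTo⁺; ∈-map⁺)
open import Data.List.Relation.Unary.All using (All; []; _∷_)
import Data.List.Relation.Unary.All as All
open import Data.List.Relation.Unary.All.Properties using (all-filter)
open import Data.List.Relation.Unary.AllPairs using ([]; _∷_)
open import Data.List.Relation.Unary.Unique.Propositional using (Unique)
open import Data.List.Relation.Unary.Unique.Propositional.Properties using (filter⁺; upTo⁺)
open import Data.Product using (_×_; _,_; Σ; ∃-syntax; proj₁; proj₂)
open import Data.Sum using (inj₁; inj₂; [_,_]′)
open import Relation.Nullary using (¬_; contradiction)
open import Relation.Nullary.Decidable using (_×-dec_)
open import Relation.Binary.PropositionalEquality using (_≡_; _≢_; refl; sym; trans; cong; subst; subst₂)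

-- Identities for products and powers.

*-interchange : ∀ a b c d → a * b * (c * d) ≡ a * c * (b * d)
*-interchange = solve-∀

^-distribʳ-* : ∀ m n k → (m * n) ^ k ≡ m ^ k * n ^ k
^-distribʳ-* m n zero    = refl
^-distribʳ-* m n (suc k) = trans (cong (m * n *_) (^-distribʳ-* m n k)) (*-interchange m n (m ^ k) (n ^ k))

^-exchange : ∀ m a b → (m ^ a) ^ b ≡ (m ^ b) ^ a
^-exchange m a b = trans (^-*-assoc m a b) (trans (cong (m ^_) (*-comm a b)) (sym (^-*-assoc m b a)))

n^2≡n*n : ∀ n → n ^ 2 ≡ n * n
n^2≡n*n n = cong (n *_) (*-identityʳ n)

n≤n^k : ∀ n k → 0 < k → n ≤ n ^ k
n≤n^k zero    k       0<k = z≤n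
n≤n^k n@(suc _) (suc k) 0<k = m≤m*n n (n ^ k) {{m^n≢0 n k}}

0<*⇒0<ˡ : ∀ m n → 0 < m * n → 0 < m
0<*⇒0<ˡ (suc _) _ _ = z<s

-- Bounding the square of a radical.

prime∣prime⇒≡ : ∀ {p q} → Prime p → Prime q → p ∣ q → p ≡ q
prime∣prime⇒≡ pp pq p∣q with prime⇒irreducible pq p∣q
... | inj₁ refl = contradiction pp ¬prime[1]
... | inj₂ p≡q  = p≡q

prime∣product⇒¬distinct : ∀ {p} ps → Prime p → All Prime ps → p ∣ product ps → ¬ All (p ≢_) ps
prime∣product⇒¬distinct [] pp [] p∣1 [] with ∣1⇒≡1 p∣1
... | refl = ¬prime[1] pp
prime∣product⇒¬distinct (q ∷ ps) pp (pq ∷ pps) p∣ (p≢q ∷ p∉ps) with euclidsLemma q (product ps) pp p∣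
... | inj₁ p∣q = p≢q (prime∣prime⇒≡ pp pq p∣q)
... | inj₂ p∣ps = prime∣product⇒¬distinct ps pp pps p∣ps p∉ps

-- Euclid's lemma is used twice: the first factor p is split off from c and cancelled, and the
-- second must again come from the cofactor.
prime²∣*⇒∣ : ∀ {p} c m → Prime p → ¬ p ∣ m → p * p ∣ c * m → p * p ∣ c
prime²∣*⇒∣ {p} c m pp p∤m p²∣cm with euclidsLemma c m pp (m*n∣⇒m∣ p p p²∣cm)
... | inj₂ p∣m = contradiction p∣m p∤m
... | inj₁ (divides e refl) with euclidsLemma e m pp (*-cancelˡ-∣ p {{prime⇒nonZero pp}}
    (subst (p * p ∣_) (rearrange e p m) p²∣cm))
  where
  rearrange : ∀ e p m → e * p * m ≡ p * (e * m)
  rearrange = solve-∀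
... | inj₁ p∣e = *-monoˡ-∣ p p∣e
... | inj₂ p∣m = contradiction p∣m p∤m

-- Write H as c · Q², with Q the product of the tail. The head p differs from all primes of the
-- tail, so p does not divide Q² and p² has to divide c.
product²∣ : ∀ {H} ps → All Prime ps → Unique ps → All (λ p → p * p ∣ H) ps → product ps * product ps ∣ H
product²∣ [] [] [] [] = 1∣ _
product²∣ (p ∷ ps) (pp ∷ pps) (p∉ps ∷ u) (p²∣H ∷ ps²∣H) with product²∣ ps pps u ps²∣H
... | divides c refl = subst (_∣ c * (Q * Q)) (rearrange p Q)
    (*-monoˡ-∣ (Q * Q) (prime²∣*⇒∣ c (Q * Q) pp p∤Q² p²∣H))
  where
  Q = product ps
  p∤Q : ¬ p ∣ Q
  p∤Q h = prime∣product⇒¬distinct ps pp pps h p∉ps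
  p∤Q² : ¬ p ∣ Q * Q
  p∤Q² p∣ = [ p∤Q , p∤Q ]′ (euclidsLemma Q Q pp p∣)
  rearrange : ∀ p Q → p * p * (Q * Q) ≡ p * Q * (p * Q)
  rearrange = solve-∀

rad²≤ : ∀ {M H} → 0 < H → (∀ p → Prime p → p ∣ M → p * p ∣ H) → rad M * rad M ≤ H
rad²≤ {M} {H} 0<H sq = ∣⇒≤ {{>-nonZero 0<H}}
  (product²∣ _ (All.map proj₁ ps) (filter⁺ P? (upTo⁺ (suc M)))
    (All.map (λ {p} → λ (pp , p∣M) → sq p pp p∣M) ps))
  where
  P? = λ p → prime? p ×-dec (p ∣? M)
  ps = all-filter P? (upTo (suc M))

-- The abc triple of a progression.

coprime-*ˡ : ∀ {m n k} → Coprime m k → Coprime n k → Coprime (m * n) k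
coprime-*ˡ cm cn (i∣mn , i∣k) =
  cn (coprime-divisor (λ (h∣i , h∣m) → cm (h∣m , ∣-trans h∣i i∣k)) i∣mn , i∣k)

complete-square : ∀ n δ → n * (n + 2 * δ) + δ * δ ≡ (n + δ) * (n + δ)
complete-square = solve-∀

abc-triple-coprime : ∀ {n δ} → Coprime n δ → Coprime (n * (n + 2 * δ)) (δ * δ)
abc-triple-coprime {n} {δ} n⊥δ = Coprimality.sym (coprime-*ˡ δ⊥a δ⊥a)
  where
  n+2δ⊥δ : Coprime (n + 2 * δ) δ
  n+2δ⊥δ {i} (i∣l , i∣δ) =
    n⊥δ (∣m+n∣m⇒∣n (subst (i ∣_) (+-comm n (2 * δ)) i∣l) (∣n⇒∣m*n 2 i∣δ) , i∣δ)
  δ⊥a : Coprime δ (n * (n + 2 * δ))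
  δ⊥a = Coprimality.sym (coprime-*ˡ {n} {n + 2 * δ} n⊥δ n+2δ⊥δ)

-- One factor g serves all three terms: for each prime it is enough that p² divides a single one of
-- g · n, g · (n + δ), g · (n + 2δ), or else δ².
abc-triple-rad : ∀ {n δ g} → 0 < n → 0 < δ → 0 < g → PowerfulAP 3 (n * g) (δ * g) →
  let a = n * (n + 2 * δ); b = δ * δ; R = rad (a * b * (a + b)) in
  R * R ≤ g * n * (n + δ) * (n + 2 * δ) * (δ * δ)
abc-triple-rad {n} {δ} {g} 0<n 0<δ 0<g ap = rad²≤ 0<H sq
  where
  m = n + δ
  l = n + 2 * δ
  0<m : 0 < m
  0<m = ≤-trans 0<n (m≤m+n n δ)
  0<l : 0 < l
  0<l = ≤-trans 0<n (m≤m+n n (2 * δ))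
  0<H : 0 < g * n * m * l * (δ * δ)
  0<H = *-mono-< (*-mono-< (*-mono-< (*-mono-< 0<g 0<n) 0<m) 0<l) (*-mono-< 0<δ 0<δ)
  term : ∀ {p} i → i < 3 → ∀ x → n * g + i * (δ * g) ≡ g * x → Prime p → p ∣ x → p * p ∣ g * x
  term {p} i i<3 x eq pp p∣x = subst₂ _∣_ (n^2≡n*n p) eq
    (proj₂ (ap i i<3) p pp (subst (p ∣_) (sym eq) (∣n⇒∣m*n g p∣x)))
  e₀ : ∀ n δ g → n * g + 0 * (δ * g) ≡ g * n
  e₀ = solve-∀
  e₁ : ∀ n δ g → n * g + 1 * (δ * g) ≡ g * (n + δ)
  e₁ = solve-∀
  e₂ : ∀ n δ g → n * g + 2 * (δ * g) ≡ g * (n + 2 * δ)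
  e₂ = solve-∀
  r₁ : ∀ g n m l d → g * m * (n * l * d) ≡ g * n * m * l * d
  r₁ = solve-∀
  r₂ : ∀ g n m l d → g * l * (n * m * d) ≡ g * n * m * l * d
  r₂ = solve-∀
  sq-n : ∀ {p} → Prime p → p ∣ n → p * p ∣ g * n * m * l * (δ * δ)
  sq-n pp h = ∣m⇒∣m*n _ (∣m⇒∣m*n l (∣m⇒∣m*n m (term 0 (s≤s z≤n) n (e₀ n δ g) pp h)))
  sq-m : ∀ {p} → Prime p → p ∣ m → p * p ∣ g * n * m * l * (δ * δ)
  sq-m {p} pp h = subst (p * p ∣_) (r₁ g n m l (δ * δ)) (∣m⇒∣m*n _ (term 1 (s≤s (s≤s z≤n)) m (e₁ n δ g) pp h))
  sq-l : ∀ {p} → Prime p → p ∣ l → p * p ∣ g * n * m * l * (δ * δ)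
  sq-l {p} pp h = subst (p * p ∣_) (r₂ g n m l (δ * δ)) (∣m⇒∣m*n _ (term 2 (s≤s (s≤s (s≤s z≤n))) l (e₂ n δ g) pp h))
  sq-δ : ∀ {p} → p ∣ δ → p * p ∣ g * n * m * l * (δ * δ)
  sq-δ {p} h = ∣n⇒∣m*n (g * n * m * l) (∣-trans (*-monoˡ-∣ p h) (*-monoʳ-∣ δ h))
  sq : ∀ p → Prime p → p ∣ n * l * (δ * δ) * (n * l + δ * δ) → p * p ∣ g * n * m * l * (δ * δ)
  sq p pp h with euclidsLemma (n * l * (δ * δ)) _ pp h
  ... | inj₂ h₁ = [ sq-m pp , sq-m pp ]′ (euclidsLemma m m pp (subst (p ∣_) (complete-square n δ) h₁))
  ... | inj₁ h₁ with euclidsLemma (n * l) (δ * δ) pp h₁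
  ...   | inj₁ h₂ = [ sq-n pp , sq-l pp ]′ (euclidsLemma n l pp h₂)
  ...   | inj₂ h₂ = [ sq-δ , sq-δ ]′ (euclidsLemma δ δ pp h₂)

-- The abc inequality is used with ε = 1/(3+t), so that the exponent of n + δ left after
-- squaring and cancelling is 4(3+t) - 3(4+t) = t.
gap-from-rad : ∀ t C R n δ g → 0 < n → 0 < g →
  ((n + δ) * (n + δ)) ^ (3 + t) ≤ C * R ^ (3 + t + 1) →
  R * R ≤ g * n * (n + δ) * (n + 2 * δ) * (δ * δ) →
  (n * g) ^ t ≤ C * C * (δ * g * (δ * g)) ^ (4 + t)
gap-from-rad t C R n δ g 0<n 0<g abc-ineq rad-ineq = begin
  (n * g) ^ t                                      ≤⟨ ^-monoˡ-≤ t (*-monoˡ-≤ g (m≤m+n n δ)) ⟩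
  (m * g) ^ t                                      ≡⟨ ^-distribʳ-* m g t ⟩
  -- Raising the exponent of g to `e` supplies the second g that turns g · δ² into (δ · g)².
  m ^ t * g ^ t                                    ≤⟨ *-mono-≤ m^t≤ (^-monoʳ-≤ g (m≤n+m t 4)) ⟩
  C * C * (g * (δ * δ)) ^ e * g ^ e                ≡⟨ *-assoc (C * C) _ _ ⟩
  C * C * ((g * (δ * δ)) ^ e * g ^ e)              ≡⟨ cong (C * C *_) (^-distribʳ-* (g * (δ * δ)) g e) ⟨
  C * C * (g * (δ * δ) * g) ^ e                    ≡⟨ cong (λ x → C * C * x ^ e) (r₃ g δ) ⟩
  C * C * (δ * g * (δ * g)) ^ e                    ∎
  where
  open ≤-Reasoning
  m = n + δ
  e = 4 + t
  instance
    g≢0 : NonZero g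
    g≢0 = >-nonZero 0<g
    m≢0 : NonZero m
    m≢0 = >-nonZero (≤-trans 0<n (m≤m+n n δ))
    m³≢0 : NonZero ((m * m * m) ^ e)
    m³≢0 = m^n≢0 (m * m * m) e {{m*n≢0 (m * m) m {{m*n≢0 m m}}}}
  r₃ : ∀ g δ → g * (δ * δ) * g ≡ δ * g * (δ * g)
  r₃ = solve-∀
  r₅ : ∀ n δ g → g * n * (n + δ) * (n + 2 * δ) * (δ * δ) ≡ n * (n + 2 * δ) * ((n + δ) * g * (δ * δ))
  r₅ = solve-∀
  r₆ : ∀ m g d → m * m * (m * g * d) ≡ m * m * m * (g * d)
  r₆ = solve-∀
  r₇ : ∀ a b c → a * (b * c) ≡ b * (a * c)
  r₇ = solve-∀
  -- By `complete-square`, n · (n + 2δ) is at most m², so that only powers of m are left to cancel.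
  H≤ : g * n * m * (n + 2 * δ) * (δ * δ) ≤ m * m * m * (g * (δ * δ))
  H≤ = begin
    g * n * m * (n + 2 * δ) * (δ * δ)   ≡⟨ r₅ n δ g ⟩
    n * (n + 2 * δ) * (m * g * (δ * δ)) ≤⟨ *-monoˡ-≤ _
      (≤-trans (m≤m+n _ (δ * δ)) (≤-reflexive (complete-square n δ))) ⟩
    m * m * (m * g * (δ * δ))           ≡⟨ r₆ m g (δ * δ) ⟩
    m * m * m * (g * (δ * δ))           ∎
  split : (m * m * m) ^ e * m ^ t ≡ (m * m) ^ (3 + t) * (m * m) ^ (3 + t)
  split = begin-equality
    (m * m * m) ^ e * m ^ t
      ≡⟨ cong (_* m ^ t) (trans (^-distribʳ-* (m * m) m e) (cong (_* m ^ e) (^-distribʳ-* m m e))) ⟩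
    m ^ e * m ^ e * m ^ e * m ^ t
      ≡⟨ r₉ m (m ^ t) ⟩
    m ^ (3 + t) * m ^ (3 + t) * (m ^ (3 + t) * m ^ (3 + t))
      ≡⟨ cong (λ x → x * x) (^-distribʳ-* m m (3 + t)) ⟨
    (m * m) ^ (3 + t) * (m * m) ^ (3 + t) ∎
    where
    r₉ : ∀ m x → m * (m * (m * (m * x))) * (m * (m * (m * (m * x)))) * (m * (m * (m * (m * x)))) * x
      ≡ m * (m * (m * x)) * (m * (m * (m * x))) * (m * (m * (m * x)) * (m * (m * (m * x))))
    r₉ = solve-∀
  m^t≤ : m ^ t ≤ C * C * (g * (δ * δ)) ^ e
  m^t≤ = *-cancelˡ-≤ ((m * m * m) ^ e) (begin
    (m * m * m) ^ e * m ^ t                         ≡⟨ split ⟩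
    (m * m) ^ (3 + t) * (m * m) ^ (3 + t)           ≤⟨ *-mono-≤ abc-ineq abc-ineq ⟩
    C * R ^ (3 + t + 1) * (C * R ^ (3 + t + 1))     ≡⟨ cong (λ x → C * R ^ x * (C * R ^ x)) (+-comm (3 + t) 1) ⟩
    C * R ^ e * (C * R ^ e)                         ≡⟨ *-interchange C (R ^ e) C (R ^ e) ⟩
    C * C * (R ^ e * R ^ e)                         ≡⟨ cong (C * C *_) (^-distribʳ-* R R e) ⟨
    C * C * (R * R) ^ e                             ≤⟨ *-monoʳ-≤ (C * C) (^-monoˡ-≤ e (≤-trans rad-ineq H≤)) ⟩
    C * C * (m * m * m * (g * (δ * δ))) ^ e         ≡⟨ cong (C * C *_) (^-distribʳ-* (m * m * m) (g * (δ * δ)) e) ⟩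
    C * C * ((m * m * m) ^ e * (g * (δ * δ)) ^ e)   ≡⟨ r₇ (C * C) ((m * m * m) ^ e) ((g * (δ * δ)) ^ e) ⟩
    (m * m * m) ^ e * (C * C * (g * (δ * δ)) ^ e)   ∎)

-- This is N ≪ d^(2 + 8/t), with an exponent that tends to 2 as t grows. Dividing by the gcd
-- provides the coprimality that `ABC` demands, and g is restored afterwards.
gap : ABC → ∀ t → Σ ℕ λ K → ∀ N d → 0 < N → 0 < d → PowerfulAP 3 N d → N ^ t ≤ K * (d * d) ^ (4 + t)
gap abc t with abc 1 (3 + t) z<s z<s
... | C , bound = C * C , go
  where
  go : ∀ N d → 0 < N → 0 < d → PowerfulAP 3 N d → N ^ t ≤ C * C * (d * d) ^ (4 + t)
  go N d 0<N 0<d ap = subst₂ (λ x y → x ^ t ≤ C * C * (y * y) ^ (4 + t)) n*g≡N δ*g≡d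
    (gap-from-rad t C R n δ g 0<n 0<g
      (subst (λ x → x ^ (3 + t) ≤ C * R ^ (3 + t + 1)) (complete-square n δ)
        (bound (n * (n + 2 * δ)) (δ * δ) (*-mono-< 0<n (≤-trans 0<n (m≤m+n n (2 * δ))))
          (*-mono-< 0<δ 0<δ) (abc-triple-coprime (coprime-/gcd N d))))
      (abc-triple-rad 0<n 0<δ 0<g (subst₂ (PowerfulAP 3) (sym n*g≡N) (sym δ*g≡d) ap)))
    where
    g = gcd N d
    instance
      g≢0 : NonZero g
      g≢0 = ≢-nonZero (gcd[m,n]≢0 N d (inj₁ (m<n⇒n≢0 0<N)))
    n = N / g
    δ = d / g
    R = rad (n * (n + 2 * δ) * (δ * δ) * (n * (n + 2 * δ) + δ * δ))
    n*g≡N : n * g ≡ N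
    n*g≡N = m/n*n≡m (gcd[m,n]∣m N d)
    δ*g≡d : δ * g ≡ d
    δ*g≡d = m/n*n≡m (gcd[m,n]∣n N d)
    0<g : 0 < g
    0<g = >-nonZero⁻¹ g
    0<n : 0 < n
    0<n = 0<*⇒0<ˡ n g (subst (0 <_) (sym n*g≡N) 0<N)
    0<δ : 0 < δ
    0<δ = 0<*⇒0<ˡ δ g (subst (0 <_) (sym δ*g≡d) 0<d)

-- The lower bound 1/2.

¬bounded : ∀ {P : ℕ → ℕ → Set} A B → (∀ {N d} → P N d → N ≤ A × d ≤ B) →
  ¬ ((L : List (ℕ × ℕ)) → ∃[ N ] ∃[ d ] ((N , d) ∉ L × P N d))
-- The box of all pairs up to (A , B) is a finite list, and it catches every pair satisfying `P`.
¬bounded A B bnd inf with inf (cartesianProduct (upTo (suc A)) (upTo (suc B)))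
... | N , d , ∉L , PNd = ∉L (∈-cartesianProduct⁺ (∈-upTo⁺ (s≤s (proj₁ (bnd PNd))))
  (∈-upTo⁺ (s≤s (proj₂ (bnd PNd)))))

-- t = 8p + 1 is chosen so that t (2p + 1) = 2p (4 + t) + 1.
bounded-N : ∀ K C p q t N d → t ≡ suc (8 * p) → 2 * p < q → 0 < N →
  N ^ t ≤ K * (d * d) ^ (4 + t) → d ^ q ≤ C * N ^ p →
  N ≤ K ^ q * (C * C) ^ (4 + t)
bounded-N K C p q t N d t≡ 2p<q 0<N gap-ineq small = *-cancelʳ-≤ N _ (N ^ E) (begin
  N * N ^ E                                         ≡⟨ cong (N ^_) exponent ⟩
  N ^ (t * suc (2 * p))                             ≤⟨ ^-monoʳ-≤ N (*-monoʳ-≤ t 2p<q) ⟩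
  N ^ (t * q)                                       ≡⟨ ^-*-assoc N t q ⟨
  (N ^ t) ^ q                                       ≤⟨ ^-monoˡ-≤ q gap-ineq ⟩
  (K * (d * d) ^ e) ^ q                             ≡⟨ ^-distribʳ-* K _ q ⟩
  K ^ q * ((d * d) ^ e) ^ q                         ≡⟨ cong (K ^ q *_) (^-exchange (d * d) e q) ⟩
  K ^ q * ((d * d) ^ q) ^ e                         ≡⟨ cong (λ x → K ^ q * x ^ e) (^-distribʳ-* d d q) ⟩
  K ^ q * (d ^ q * d ^ q) ^ e                       ≤⟨ *-monoʳ-≤ (K ^ q) (^-monoˡ-≤ e (*-mono-≤ small small)) ⟩
  K ^ q * (C * N ^ p * (C * N ^ p)) ^ e             ≡⟨ cong (λ x → K ^ q * x ^ e) (*-interchange C (N ^ p) C (N ^ p)) ⟩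
  K ^ q * (C * C * (N ^ p * N ^ p)) ^ e             ≡⟨ cong (λ x → K ^ q * (C * C * x) ^ e) (^-distribˡ-+-* N p p) ⟨
  K ^ q * (C * C * N ^ (p + p)) ^ e                 ≡⟨ cong (K ^ q *_) (^-distribʳ-* (C * C) _ e) ⟩
  K ^ q * ((C * C) ^ e * (N ^ (p + p)) ^ e)         ≡⟨ cong (λ x → K ^ q * ((C * C) ^ e * x)) (^-*-assoc N (p + p) e) ⟩
  K ^ q * ((C * C) ^ e * N ^ E)                     ≡⟨ *-assoc (K ^ q) _ _ ⟨
  K ^ q * (C * C) ^ e * N ^ E                       ∎)
  where
  open ≤-Reasoning
  e = 4 + t
  E = (p + p) * e
  instance
    N≢0 : NonZero N
    N≢0 = >-nonZero 0<N
    N^E≢0 : NonZero (N ^ E)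
    N^E≢0 = m^n≢0 N E
  r₂ : ∀ p → suc ((p + p) * (4 + suc (8 * p))) ≡ suc (8 * p) * suc (2 * p)
  r₂ = solve-∀
  exponent : suc E ≡ t * suc (2 * p)
  exponent = subst (λ x → suc ((p + p) * (4 + x)) ≡ x * suc (2 * p)) (sym t≡) (r₂ p)

-- If p/q is below 1/2, the gap inequality bounds N. Then d is bounded too, since q > 0 gives d ≤
-- d^q ≤ C · N^p, and only finitely many pairs remain.
¬admissible : ∀ k p q K t → t ≡ suc (8 * p) → 3 ≤ k → 2 * p < q →
  (∀ N d → 0 < N → 0 < d → PowerfulAP 3 N d → N ^ t ≤ K * (d * d) ^ (4 + t)) →
  ¬ Admissible k p q
¬admissible k p q K t t≡ 3≤k 2p<q gap-ineq (0<p , p<q , C , inf) = ¬bounded A (C * A ^ p) bounds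
  λ L → let N , d , 0<N , 0<d , ∉L , ap , small = inf L in N , d , ∉L , 0<N , 0<d , ap , small
  where
  A = K ^ q * (C * C) ^ (4 + t)
  bounds : ∀ {N d} → 0 < N × 0 < d × PowerfulAP k N d × d ^ q ≤ C * N ^ p → N ≤ A × d ≤ C * A ^ p
  bounds {N} {d} (0<N , 0<d , ap , small) = N≤A , d≤
    where
    N≤A : N ≤ A
    N≤A = bounded-N K C p q t N d t≡ 2p<q 0<N (gap-ineq N d 0<N 0<d (λ i i<3 → ap i (≤-trans i<3 3≤k))) small
    d≤ : d ≤ C * A ^ p
    d≤ = ≤-trans (n≤n^k d q (≤-trans z<s p<q)) (≤-trans small (*-monoʳ-≤ C (^-monoˡ-≤ p N≤A)))

halfLeTheta : ABC → ∀ k → 3 ≤ k → HalfLeTheta k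
halfLeTheta abc k 3≤k p q adm = ≮⇒≥ λ 2p<q →
  -- The exponent p/q is fixed before `K` is taken, so t may depend on p.
  let t = suc (8 * p) ; K , gap-ineq = gap abc t in ¬admissible k p q K t refl 3≤k 2p<q gap-ineq adm

-- Powerful progressions from Pell's equation.

powerful-m*m*c : ∀ m c → 0 < m → c ∣ m → Powerful (m * m * c)
powerful-m*m*c m c 0<m c∣m = *-mono-< (*-mono-< 0<m 0<m) 0<c , sq
  where
  0<c : 0 < c
  0<c = n≢0⇒n>0 λ { refl → m<n⇒n≢0 0<m (0∣⇒≡0 c∣m) }
  m-case : ∀ {p} → p ∣ m → p ^ 2 ∣ m * m * c
  m-case {p} p∣m = ∣m⇒∣m*n c (subst (_∣ m * m) (sym (n^2≡n*n p)) (∣-trans (*-monoˡ-∣ p p∣m) (*-monoʳ-∣ m p∣m)))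
  sq : ∀ p → Prime p → p ∣ m * m * c → p ^ 2 ∣ m * m * c
  sq p pp h with euclidsLemma (m * m) c pp h
  ... | inj₁ h₁ = [ m-case , m-case ]′ (euclidsLemma m m pp h₁)
  -- A prime factor of c already divides m, so m * m alone supplies its square.
  ... | inj₂ h₁ = m-case (∣-trans h₁ c∣m)

-- Each step multiplies y + w√8 by the unit 3 + √8, which has norm 1. As y is positive, w grows at
-- every step and passes any B.
pell : ∀ B → ∃[ y ] ∃[ w ] (B < w × 1 + 8 * (w * w) ≡ y * y)
pell zero = 3 , 1 , z<s , refl
pell (suc B) with pell B
... | y , w , B<w , eq = 3 * y + 8 * w , y + 3 * w , grows ,
    trans (step₁ y w) (trans (cong (λ x → 8 * (y * y) + 48 * (y * w) + 64 * (w * w) + x) eq) (step₂ y w))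
  where
  step₁ : ∀ y w → 1 + 8 * ((y + 3 * w) * (y + 3 * w))
    ≡ 8 * (y * y) + 48 * (y * w) + 64 * (w * w) + (1 + 8 * (w * w))
  step₁ = solve-∀
  step₂ : ∀ y w → 8 * (y * y) + 48 * (y * w) + 64 * (w * w) + y * y ≡ (3 * y + 8 * w) * (3 * y + 8 * w)
  step₂ = solve-∀
  grows : suc B < y + 3 * w
  grows = +-mono-≤ (0<*⇒0<ˡ y y (subst (0 <_) eq z<s)) (≤-trans B<w (m≤m+n w _))

-- Here j stands for k - 2: the terms n and n + 1 contribute no factor, because the Pell solution
-- already makes them twice a square and a square.
G : ℕ → ℕ → ℕ
G zero    n = 1
G (suc j) n = (n + (2 + j)) * G j n

0<G : ∀ j n → 0 < G j n
0<G zero    n = z<s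
0<G (suc j) n = *-mono-< (≤-trans z<s (m≤n+m (2 + j) n)) (0<G j n)

∣G : ∀ {i} j n → i < j → n + (2 + i) ∣ G j n
∣G (suc j) n i<1+j with m<1+n⇒m<n∨m≡n i<1+j
... | inj₁ i<j  = ∣n⇒∣m*n (n + (2 + j)) (∣G j n i<j)
... | inj₂ refl = m∣m*n (G j n)

-- For positive n, each of the j factors is at most a constant times n.
G≤ : ∀ j → Σ ℕ λ B → ∀ n → 0 < n → G j n ≤ B * n ^ j
G≤ zero = 1 , λ _ _ → ≤-refl
G≤ (suc j) with G≤ j
... | B , bound = (3 + j) * B , λ n 0<n → begin
  (n + (2 + j)) * G j n           ≤⟨ *-mono-≤ (+-monoʳ-≤ n (m≤m*n (2 + j) n {{>-nonZero 0<n}})) (bound n 0<n) ⟩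
  (3 + j) * n * (B * n ^ j)       ≡⟨ *-interchange (3 + j) n B (n ^ j) ⟩
  (3 + j) * B * (n * n ^ j)       ∎
  where
  open ≤-Reasoning

pell-AP : ∀ j y w → 0 < w → 1 + 8 * (w * w) ≡ y * y →
  let n = 8 * (w * w); g = G j n in PowerfulAP (2 + j) (n * (g * g)) (g * g)
pell-AP j y w 0<w eq = term
  where
  n = 8 * (w * w)
  g = G j n
  0<y : 0 < y
  0<y = 0<*⇒0<ˡ y y (subst (0 <_) eq z<s)
  r₀ : ∀ w g → (2 * w * g) * (2 * w * g) * 2 ≡ 8 * (w * w) * (g * g) + 0 * (g * g)
  r₀ = solve-∀
  r₁ : ∀ y g → (y * g) * (y * g) * 1 ≡ y * y * (g * g)
  r₁ = solve-∀
  r₁′ : ∀ n g → (1 + n) * g ≡ n * g + 1 * g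
  r₁′ = solve-∀
  r₂ : ∀ i n g → g * (n + (2 + i)) ≡ n * g + (2 + i) * g
  r₂ = solve-∀
  term : PowerfulAP (2 + j) (n * (g * g)) (g * g)
  -- Since n = 8w² is 2 · (2w)², the leftover factor 2 divides the root 2wg.
  term zero _ = subst Powerful (r₀ w g)
    (powerful-m*m*c (2 * w * g) 2 (*-mono-< (*-mono-< {0} {2} z<s 0<w) (0<G j n)) (∣m⇒∣m*n g (m∣m*n w)))
  term (suc zero) _ = subst Powerful (trans (r₁ y g) (trans (cong (_* (g * g)) (sym eq)) (r₁′ n (g * g))))
    (powerful-m*m*c (y * g) 1 (*-mono-< 0<y (0<G j n)) (1∣ _))
  -- Here n + (2 + i) is itself one of the factors of g.
  term (suc (suc i)) i<k = subst Powerful (r₂ i n (g * g))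
    (powerful-m*m*c g (n + (2 + i)) (0<G j n) (∣G j n (s≤s⁻¹ (s≤s⁻¹ i<k))))

-- With N = n · d, the factor d^e occurs on both sides of d^(e+1) ≤ B² · N^e, so d ≤ B² · n^e
-- suffices. This follows from d = G² ≤ B² · n^(2j). Leaving e free above 2j lets the weaker
-- exponents of the theorem be reached directly.
admissible : ∀ j e → 0 < e → 2 * j ≤ e → Admissible (2 + j) e (suc e)
admissible j e 0<e 2j≤e with G≤ j
... | B , G-bound = 0<e , ≤-refl , B * B , construct
  where
  construct : (L : List (ℕ × ℕ)) → ∃[ N ] ∃[ d ] (0 < N × 0 < d × (N , d) ∉ L ×
    PowerfulAP (2 + j) N d × d ^ suc e ≤ B * B * N ^ e)
  -- Taking w above every first component in L makes N ≥ n ≥ w too large to occur there.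
  construct L with pell (max 0 (map proj₁ L))
  ... | y , w , large , eq = n * d , d , *-mono-< 0<n 0<d , 0<d , fresh , pell-AP j y w 0<w eq , small
    where
    open ≤-Reasoning
    0<w : 0 < w
    0<w = ≤-trans z<s large
    n = 8 * (w * w)
    g = G j n
    d = g * g
    0<n : 0 < n
    0<n = *-mono-< {0} {8} z<s (*-mono-< 0<w 0<w)
    0<d : 0 < d
    0<d = *-mono-< (0<G j n) (0<G j n)
    instance
      n≢0 : NonZero n
      n≢0 = >-nonZero 0<n
      d≢0 : NonZero d
      d≢0 = >-nonZero 0<d
      w≢0 : NonZero w
      w≢0 = >-nonZero 0<w
    fresh : (n * d , d) ∉ L
    fresh ∈L = <⇒≱ large (begin
      w               ≤⟨ m≤m*n w w ⟩
      w * w           ≤⟨ m≤n*m (w * w) 8 ⟩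
      n               ≤⟨ m≤m*n n d ⟩
      n * d           ≤⟨ All.lookup (xs≤max 0 (map proj₁ L)) (∈-map⁺ proj₁ ∈L) ⟩
      max 0 (map proj₁ L) ∎)
    d≤ : d ≤ B * B * n ^ e
    d≤ = begin
      g * g                           ≤⟨ *-mono-≤ (G-bound n 0<n) (G-bound n 0<n) ⟩
      B * n ^ j * (B * n ^ j)         ≡⟨ *-interchange B (n ^ j) B (n ^ j) ⟩
      B * B * (n ^ j * n ^ j)         ≡⟨ cong (B * B *_) (^-distribˡ-+-* n j j) ⟨
      B * B * n ^ (j + j)             ≡⟨ cong (λ x → B * B * n ^ (j + x)) (+-identityʳ j) ⟨
      B * B * n ^ (2 * j)             ≤⟨ *-monoʳ-≤ (B * B) (^-monoʳ-≤ n 2j≤e) ⟩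
      B * B * n ^ e                   ∎
    small : d ^ suc e ≤ B * B * (n * d) ^ e
    small = begin
      d * d ^ e                       ≤⟨ *-monoˡ-≤ (d ^ e) d≤ ⟩
      B * B * n ^ e * d ^ e           ≡⟨ *-assoc (B * B) _ _ ⟩
      B * B * (n ^ e * d ^ e)         ≡⟨ cong (B * B *_) (^-distribʳ-* n d e) ⟨
      B * B * (n * d) ^ e             ∎

-- The upper bounds on the exponents.

admissible⇒thetaLe : ∀ {k p q} → Admissible k p q → ThetaLe k p q
-- The same p/q works for every ε, as p/q < p/q + r/s.
admissible⇒thetaLe {k} {p} {q} adm@(_ , p<q , _) r s 0<r 0<s = p , q , adm , (begin-strict
  p * q * s           ≡⟨ r₁ p q s ⟩
  q * (p * s)         <⟨ *-monoʳ-< q {{>-nonZero 0<q}} (m<m+n (p * s) (*-mono-< 0<r 0<q)) ⟩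
  q * (p * s + r * q) ∎)
  where
  open ≤-Reasoning
  0<q : 0 < q
  0<q = ≤-trans z<s p<q
  r₁ : ∀ p q s → p * q * s ≡ q * (p * s)
  r₁ = solve-∀

-- This is the bound 1 - 1/E; the smallest E allowed is 2j + 1 = 2k - 3.
thetaLe : ∀ j E → 0 < j → 2 * j < E → ThetaLe (2 + j) (E ∸ 1) E
thetaLe j (suc e) 0<j 2j<E = admissible⇒thetaLe (admissible j e (≤-trans (≤-trans 0<j (m≤n*m j 2)) 2j≤e) 2j≤e)
  where
  2j≤e = s≤s⁻¹ 2j<E

-- For k = 5 + m, a step in m adds 2 on the left and at least 20 on the right, starting from 6 < 10.
2*[k∸2]<D : ∀ m → 2 * (3 + m) < 10 * 3 ^ m
2*[k∸2]<D zero    = m≤m+n 7 3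
2*[k∸2]<D (suc m) = begin-strict
  2 * (3 + suc m)             ≡⟨ r₁ m ⟩
  2 * (3 + m) + 2             <⟨ +-mono-<-≤ (2*[k∸2]<D m)
    (*-mono-≤ {1} {3 ^ m} {2} {20} (m^n>0 3 m) (m≤m+n 2 18)) ⟩
  10 * 3 ^ m + 3 ^ m * 20     ≡⟨ r₂ (3 ^ m) ⟩
  10 * (3 * 3 ^ m)            ∎
  where
  open ≤-Reasoning
  r₁ : ∀ m → 2 * (3 + suc m) ≡ 2 * (3 + m) + 2
  r₁ = solve-∀
  r₂ : ∀ x → 10 * x + x * 20 ≡ 10 * (3 * x)
  r₂ = solve-∀

theta-≥5 : ∀ k → 5 ≤ k → ThetaLe k (D k ∸ 1) (D k)
-- Matching exposes k as 5 + m, so that `D k` computes to 10 · 3^m.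
theta-≥5 _ (s≤s (s≤s (s≤s (s≤s (s≤s {n = m} z≤n))))) = thetaLe (3 + m) (10 * 3 ^ m) z<s (2*[k∸2]<D m)

theorem3 : ABC →
    ((HalfLeTheta 4 × ThetaLe 4 4 5) ×
    (HalfLeTheta 5 × ThetaLe 5 9 10) ×
    (∀ (k : ℕ) → 5 ≤ k → HalfLeTheta k × ThetaLe k (D k ∸ 1) (D k)))
theorem3 abc =
  (halfLeTheta abc 4 (m≤m+n 3 1) , thetaLe 2 5 z<s ≤-refl) ,
  -- `D 5` computes to 10, so the general bound reads 9/10 here.
  (halfLeTheta abc 5 (m≤m+n 3 2) , theta-≥5 5 ≤-refl) ,
  (λ k 5≤k → halfLeTheta abc k (≤-trans (m≤m+n 3 2) 5≤k) , theta-≥5 k 5≤k)
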